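{- Let $(V,\to,\Omega,\mathcal P)$ be a parity game. For all $v,w\in V$: $v\sqsubseteq_{de}w$ (Duplicator has a winning strategy in the delayed simulation game from $(v,w)$ with obligation $\gamma(v,w,\checkmark)$) if and only if $v\leq_{de}w$ (there is a well-founded delayed simulation $R$ with $v\,R^{\gamma(v,w,\checkmark)}\,w$).
   Context: A parity game is a tuple $(V,\to,\Omega,\mathcal P)$ where $V$ is a finite set of vertices, $\to\subseteq V\times V$ is total (every vertex has at least one successor), $\Omega:V\to\mathbb N$ is a priority function, and $\mathcal P:V\to\{\Diamond,\Box\}$ assigns each vertex to player even ($\Diamond$) or odd ($\Box$). Write $V_\Diamond,V_\Box$ for the vertices owned by each player and $v^\bullet=\{w\mid v\to w\}$. One-step forcing: for $v\in V$, $T\subseteq V$ and a player $i$, $v\to_i T$ means: either $\mathcal P(v)=i$ and $v^\bullet\cap T\neq\emptyset$, or $\mathcal P(v)\neq i$ and $v^\bullet\subseteq T$. Reward order on $\mathbb N$: $n\preccurlyeq m$ iff $n$ is even and $m$ is odd; or both are even and $n\le m$; or both are odd and $m\le n$. Minimum is always with respect to the usual order. Obligations: $K=\mathbb N\cup\{\checkmark\}$. The update $\gamma:\mathbb N\times\mathbb N\times K\to K$ is: $\gamma(n,m,\checkmark)=\checkmark$ if $m\preccurlyeq n$, and $\min\{n,m\}$ otherwise; for $k\in\mathbb N$, $\gamma(n,m,k)=\checkmark$ if $m\preccurlyeq n$ and ($n$ is odd and $n\le k$, or $m$ is even and $m\le k$), and $\gamma(n,m,k)=\min\{n,m,k\}$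 otherwise. For vertices, $\gamma(v,w,k)$ abbreviates $\gamma(\Omega(v),\Omega(w),k)$. Delayed simulation game: played by Spoiler and Duplicator in rounds on positions $(v,w)\in V\times V$ with an obligation $k\in K$. In a round from $(v,w)$ with obligation $k$, moves $v\to v'$ and $w\to w'$ are chosen as follows: - $\mathcal P(v)=\Diamond,\mathcal P(w)=\Diamond$: Spoiler chooses $v'$, then Duplicator chooses $w'$; - $\mathcal P(v)=\Diamond,\mathcal P(w)=\Box$: Spoiler chooses $v'$, then Spoiler chooses $w'$; - $\mathcal P(v)=\Box,\mathcal P(w)=\Diamond$: Duplicator chooses $w'$, then Duplicator chooses $v'$; - $\mathcal P(v)=\Box,\mathcal P(w)=\Box$: Spoiler chooses $w'$, then Duplicator chooses $v'$. The game continues from $(v',w')$ with obligation $\gamma(v',w',k)$. An infinite play $(v_0,w_0,k_0),(v_1,w_1,k_1),\dots$ is won by Duplicator iff $k_j=\checkmark$ for infinitely many $j$; otherwise Spoiler wins. Well-founded delayed simulation: a relation $R\subseteq V\times K\times V$, written $v\,R^k\,w$ for $(v,k,w)\in R$, is a well-founded delayed simulation iff there is a well-founded order $\lessdot$ on $V\times V\times K$ such that for all $v,w\in V$, $k\in K$ with $v\,R^k\,w$: - if $v\in V_\Diamond$, then for all $v'\in v^\bullet$: $w\to_\Diamond\{w'\in V\mid v'\,R^{\ell}\,w'\text{ and }(k=\checkmark\text{ or }(v',w',\ell)\lessdot(v,w,k)),\text{ where }\ell=\gamma(v',w',k)\}$; - if $v\in V_\Box$, then $w\to_\Diamond\{w'\in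 V\mid \exists v'\in v^\bullet:\ v'\,R^{\ell}\,w'\text{ and }(k=\checkmark\text{ or }(v',w',\ell)\lessdot(v,w,k)),\text{ where }\ell=\gamma(v',w',k)\}$. -}

module Defs where

open import Data.Bool.Base using (if_then_else_)
open import Data.Fin.Base using (Fin)
open import Data.List.Base using (List; applyDownFrom)
open import Data.Nat.Base using (ℕ; suc; _≤_; _⊓_; parity)
open import Data.Nat.Properties using (_≤?_)
open import Data.Parity using (0ℙ; 1ℙ) renaming (_≟_ to _≟ℙ_)
open import Data.Product.Base using (Σ; ∃; ∃-syntax; _×_; _,_; proj₁; proj₂)
open import Data.Sum.Base using (_⊎_)
open import Data.Unit.Base using (⊤)
open import Function.Bundles using (_↔_)
open import Induction.WellFounded using (WellFounded)
open import Level using (0ℓ)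
open import Relation.Binary.Core using (Rel)
open import Relation.Binary.Definitions using (Decidable)
open import Relation.Binary.PropositionalEquality.Core using (_≡_; _≢_)
open import Relation.Binary.Structures using (IsStrictPartialOrder)
open import Relation.Nullary.Decidable using (Dec; does; _×-dec_; _⊎-dec_)
open import Relation.Unary using (Pred; _⊆_; _≬_)

data Player : Set where
  ◇ □ : Player

-- A subset of V × V for finite V is a decidable relation, whence _⟶?_.
record ParityGame : Set₁ where
  infix 4 _⟶_ _⟶?_
  field
    V      : Set
    finite : ∃[ n ] (V ↔ Fin n)
    _⟶_    : Rel V 0ℓ
    _⟶?_   : Decidable _⟶_
    total  : ∀ v → ∃[ w ] v ⟶ w
    Ω      : V → ℕ
    owner  : V → Player

Even Odd : Pred ℕ 0ℓ
Even n = parity n ≡ 0ℙ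
Odd  n = parity n ≡ 1ℙ

even? : ∀ n → Dec (Even n)
even? n = parity n ≟ℙ 0ℙ

odd? : ∀ n → Dec (Odd n)
odd? n = parity n ≟ℙ 1ℙ

infix 4 _≼_ _≼?_

_≼_ : Rel ℕ 0ℓ
n ≼ m = (Even n × Odd m)
      ⊎ (Even n × Even m × n ≤ m)
      ⊎ (Odd n × Odd m × m ≤ n)

_≼?_ : Decidable _≼_
n ≼? m = (even? n ×-dec odd? m)
  ⊎-dec (even? n ×-dec even? m ×-dec n ≤? m)
  ⊎-dec (odd? n ×-dec odd? m ×-dec m ≤? n)

data K : Set where
  ✓    : K
  owed : ℕ → K

γ : ℕ → ℕ → K → K
γ n m ✓ =
  if does (m ≼? n) then ✓ else owed (n ⊓ m)
γ n m (owed k) =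
  if does ((m ≼? n) ×-dec ((odd? n ×-dec n ≤? k) ⊎-dec (even? m ×-dec m ≤? k)))
  then ✓
  else owed (n ⊓ m ⊓ k)

module DelayedSimulation (G : ParityGame) where
  open ParityGame G

  _• : V → Pred V 0ℓ
  v • = v ⟶_

  infix 4 _⟶⟨_⟩_
  _⟶⟨_⟩_ : V → Player → Pred V 0ℓ → Set
  v ⟶⟨ i ⟩ T = (owner v ≡ i × (v •) ≬ T) ⊎ (owner v ≢ i × (v •) ⊆ T)

  γᵥ : V → V → K → K
  γᵥ v w = γ (Ω v) (Ω w)

  Position : Set
  Position = V × V × K

  Succ : V → Set
  Succ v = ∃ (v •)

  -- Duplicator's part of a round from (v , w), given the owners of v and w.
  -- A choice made after Spoiler's is a function of Spoiler's choice.
  Response : (i j : Player) → V → V → Set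
  Response ◇ ◇ v w = Succ v → Succ w
  Response ◇ □ v w = ⊤
  Response □ ◇ v w = Succ w × Succ v
  Response □ □ v w = Succ w → Succ v

  -- The pairs (v′ , w′) Spoiler can bring about against a given response.
  Outcome : ∀ i j {v w} → Response i j v w → V → V → Set
  Outcome ◇ ◇ {v} {w} f       v′ w′ = Σ (v ⟶ v′) λ e → w′ ≡ proj₁ (f (v′ , e))
  Outcome ◇ □ {v} {w} _       v′ w′ = v ⟶ v′ × w ⟶ w′
  Outcome □ ◇ {v} {w} (t , s) v′ w′ = w′ ≡ proj₁ t × v′ ≡ proj₁ s
  Outcome □ □ {v} {w} f       v′ w′ = Σ (w ⟶ w′) λ e → v′ ≡ proj₁ (f (w′ , e))

  -- The list holds the earlier positions of the play, most recent first.
  Strategy : Set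
  Strategy = List Position → ((v , w , k) : Position) →
             Response (owner v) (owner w) v w

  Step : (p : Position) →
         Response (owner (proj₁ p)) (owner (proj₁ (proj₂ p)))
                  (proj₁ p) (proj₁ (proj₂ p)) →
         Position → Set
  Step (v , w , k) r (v′ , w′ , k′) =
    Outcome (owner v) (owner w) r v′ w′ × k′ ≡ γᵥ v′ w′ k

  Consistent : Strategy → (ℕ → Position) → Set
  Consistent σ π = ∀ j → Step (π j) (σ (applyDownFrom π j) (π j)) (π (suc j))

  obligation : Position → K
  obligation (_ , _ , k) = k

  WonByDuplicator : (ℕ → Position) → Set
  WonByDuplicator π = ∀ n → ∃[ j ] n ≤ j × obligation (π j) ≡ ✓

  Winning : Strategy → Position → Set
  Winning σ p = ∀ π → π 0 ≡ p → Consistent σ π → WonByDuplicator π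

  infix 4 _⊑de_ _≤de_

  _⊑de_ : V → V → Set
  v ⊑de w = ∃[ σ ] Winning σ (v , w , γᵥ v w ✓)

  record IsWellFoundedDelayedSimulation (R : V → K → V → Set) : Set₁ where
    infix 4 _⋖_
    field
      _⋖_                  : Rel Position 0ℓ
      isStrictPartialOrder : IsStrictPartialOrder _≡_ _⋖_
      wellFounded          : WellFounded _⋖_

    Good : V → V → K → V → V → Set
    Good v w k v′ w′ =
      let ℓ = γᵥ v′ w′ k
      in R v′ ℓ w′ × (k ≡ ✓ ⊎ (v′ , w′ , ℓ) ⋖ (v , w , k))

    field
      simulate-◇ : ∀ {v w k} → R v k w → owner v ≡ ◇ →
                   ∀ v′ → v ⟶ v′ →
                   w ⟶⟨ ◇ ⟩ (λ w′ → Good v w k v′ w′)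
      simulate-□ : ∀ {v w k} → R v k w → owner v ≡ □ →
                   w ⟶⟨ ◇ ⟩ (λ w′ → ∃[ v′ ] v ⟶ v′ × Good v w k v′ w′)

  _≤de_ : V → V → Set₁
  v ≤de w = ∃[ R ] IsWellFoundedDelayedSimulation R × R v (γᵥ v w ✓) w

-- Both relations hold exactly when the initial position lies in the Büchi
-- region W = νY. μX. Φ Y X, where a position belongs to Φ Y X when Duplicator
-- can force the next position into Y (if the current obligation is ✓) or into
-- X (otherwise).  Obligations arising in play are bounded by priorities, so
-- the iterations stabilise and W is decidable.
--
-- The region W is itself a well-founded delayed simulation, ordered by the
-- stage of the inner iteration, and it contains every other one.  Being
-- decidable, it yields a strategy for Duplicator.  Outside W, Spoiler can
-- descend in the stages of the outer iteration at each visit of ✓, so no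
-- strategy wins there.
module Submission where

open import Defs
open import Data.Bool.Base using (true; false)
open import Data.Fin.Properties using (any?; all?)
open import Data.List.Base using
  (List; []; _∷_; allFin; map; cartesianProduct; concatMap; applyUpTo; applyDownFrom)
open import Data.List.Membership.Propositional using (_∈_; lose)
open import Data.List.Membership.Propositional.Properties using
  (∈-map⁺; ∈-allFin; ∈-cartesianProduct⁺; ∈-concatMap⁺; ∈-applyUpTo⁺)
open import Data.List.Relation.Unary.Any using (here; there)
open import Data.Nat.Base using
  (ℕ; zero; suc; pred; s≤s; _+_; _≤_; _<_; _≤′_; ≤′-refl; ≤′-step)
open import Data.Nat.GeneralisedArithmetic using (fold)
open import Data.Nat.Properties using
  (≤-refl; ≤-trans; ≤-pred; pred[n]≤n; <⇒≤; ≤⇒≤′; ≰⇒>; m⊓n≤m; _≤?_)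
open import Data.Product.Base using (Σ; ∃; ∃-syntax; _×_; _,_; proj₁; proj₂)
open import Data.Sum.Base using (_⊎_; inj₁; inj₂)
open import Data.Unit.Base using (tt)
open import Function.Base using (_∘_; id)
open import Function.Bundles using (_⇔_; mk⇔; Inverse)
open import Induction.WellFounded using (Acc; acc)
open import Level using (0ℓ)
open import Relation.Binary.PropositionalEquality using
  (_≡_; refl; sym; trans; cong; subst; isEquivalence; resp₂)
open import Relation.Nullary using (¬_; Dec; yes; no; contradiction)
open import Relation.Nullary.Decidable using
  (does; map′; _×-dec_; _→-dec_; decidable-stable)
open import Relation.Unary using (Pred; Decidable; _⊆_; _≬_; ∁)
open import Relation.Unary.Properties using (∅?; U?; ∁?)

-- Stabilisation of increasing sequences on a finite list.

StableOn : {A : Set} → List A → (ℕ → Pred A 0ℓ) → ℕ → Set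
StableOn xs P n = ∀ {x} → x ∈ xs → P (suc n) x → P n x

increasing⇒⊆+ : {A : Set} (P : ℕ → Pred A 0ℓ) → (∀ n → P n ⊆ P (suc n)) →
                ∀ n m → P n ⊆ P (m + n)
increasing⇒⊆+ P inc n zero    x∈ = x∈
increasing⇒⊆+ P inc n (suc m) x∈ = inc (m + n) (increasing⇒⊆+ P inc n m x∈)

-- Abstract, so that type checking never unfolds the search for a stable index.
abstract
  increasing⇒stable : {A : Set} (xs : List A) (P : ℕ → Pred A 0ℓ) →
                      (∀ n → Decidable (P n)) → (∀ n → P n ⊆ P (suc n)) →
                      ∃ (StableOn xs P)
  increasing⇒stable []       P P? inc = 0 , λ ()
  increasing⇒stable (x ∷ xs) P P? inc with increasing⇒stable xs P P? inc
  ... | n , stable with P? (suc n) x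
  ...   | no x∉ = n , λ where
          (here refl) x∈ → contradiction x∈ x∉
          (there y∈)     → stable y∈
  -- From index `suc n` on, `x` stays in, so restarting the sequence there leaves only `xs` to
  -- stabilise.
  ...   | yes x∈ with increasing⇒stable xs (λ m → P (m + suc n))
                        (λ m → P? (m + suc n)) (λ m → inc (m + suc n))
  ...     | m , stable′ = m + suc n , λ where
            (here refl) _ → increasing⇒⊆+ P inc (suc n) m x∈
            (there y∈)    → stable′ y∈

-- Every minimum taken includes `n`, which therefore bounds the result whatever the incoming
-- obligation.
γ-bounded : ∀ n m k → γ n m k ≡ ✓ ⊎ (∃[ j ] j ≤ n × γ n m k ≡ owed j)
γ-bounded n m ✓ with does (m ≼? n)
... | true  = inj₁ refl
... | false = inj₂ (_ , m⊓n≤m n m , refl)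
γ-bounded n m (owed k)
  with does (m ≼? n) | does (odd? n ×-dec n ≤? k) | does (even? m ×-dec m ≤? k)
... | true  | true  | _     = inj₁ refl
... | true  | false | true  = inj₁ refl
... | true  | false | false = inj₂ (_ , ≤-trans (m⊓n≤m _ k) (m⊓n≤m n m) , refl)
... | false | _     | _     = inj₂ (_ , ≤-trans (m⊓n≤m _ k) (m⊓n≤m n m) , refl)

module _ (G : ParityGame) where
  open ParityGame G
  open DelayedSimulation G
  open Inverse (proj₂ finite) using (to; from; strictlyInverseʳ)

  -- Decidable quantification over the vertices.

  ∃V? : {P : Pred V 0ℓ} → Decidable P → Dec (∃ P)
  ∃V? {P} P? = map′
    (λ (i , p) → from i , p)
    (λ (v , p) → to v , subst P (sym (strictlyInverseʳ v)) p)
    (any? (P? ∘ from))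

  ∀V? : {P : Pred V 0ℓ} → Decidable P → Dec (∀ v → P v)
  ∀V? {P} P? = map′
    (λ p v → subst P (strictlyInverseʳ v) (p (to v)))
    (λ p i → p (from i))
    (all? (P? ∘ from))

  •≬? : ∀ v {T : Pred V 0ℓ} → Decidable T → Dec ((v •) ≬ T)
  •≬? v T? = ∃V? λ w → v ⟶? w ×-dec T? w

  •⊆? : ∀ v {T : Pred V 0ℓ} → Decidable T → Dec ((v •) ⊆ T)
  •⊆? v T? = map′ (λ f {w} → f w) (λ f w → f {w}) (∀V? λ w → (v ⟶? w) →-dec T? w)

  •⊈⇒escape : ∀ v {T : Pred V 0ℓ} → Decidable T → ¬ ((v •) ⊆ T) → (v •) ≬ ∁ T
  •⊈⇒escape v T? ⊈T with •≬? v (∁? T?)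
  ... | yes escape = escape
  ... | no  trapped =
    contradiction (λ {w} e → decidable-stable (T? w) λ w∉T → trapped (w , e , w∉T)) ⊈T

  -- Forcing in one round of the game.

  Reach : Player → V → Pred V 0ℓ → Set
  Reach ◇ w T = (w •) ≬ T
  Reach □ w T = (w •) ⊆ T

  Reach-map : ∀ j {w} {S T : Pred V 0ℓ} → S ⊆ T → Reach j w S → Reach j w T
  Reach-map ◇ S⊆T (w′ , e , s) = w′ , e , S⊆T s
  Reach-map □ S⊆T f e          = S⊆T (f e)

  Reach? : ∀ j w {T : Pred V 0ℓ} → Decidable T → Dec (Reach j w T)
  Reach? ◇ = •≬?
  Reach? □ = •⊆?

  Reach⇒⟶◇ : ∀ {w j} {T : Pred V 0ℓ} → owner w ≡ j → Reach j w T → w ⟶⟨ ◇ ⟩ T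
  Reach⇒⟶◇ {j = ◇} eq r = inj₁ (eq , r)
  Reach⇒⟶◇ {j = □} eq r = inj₂ ((λ ≡◇ → contradiction (trans (sym ≡◇) eq) λ ()) , r)

  ⟶◇⇒Reach : ∀ {w j} {T : Pred V 0ℓ} → owner w ≡ j → w ⟶⟨ ◇ ⟩ T → Reach j w T
  ⟶◇⇒Reach {j = ◇} eq (inj₁ (_  , r)) = r
  ⟶◇⇒Reach {j = ◇} eq (inj₂ (≢◇ , _)) = contradiction eq ≢◇
  ⟶◇⇒Reach {j = □} eq (inj₁ (≡◇ , _)) = contradiction (trans (sym ≡◇) eq) λ ()
  ⟶◇⇒Reach {j = □} eq (inj₂ (_  , r)) = r

  -- Owners are arguments so that the quantifiers compute by cases. Their order is that of the moves
  -- in a round and also that of the two simulation clauses.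
  Forces : (i j : Player) → V → V → (V → V → Set) → Set
  Forces ◇ j v w Q = (v •) ⊆ λ v′ → Reach j w (Q v′)
  Forces □ j v w Q = Reach j w λ w′ → ∃[ v′ ] v ⟶ v′ × Q v′ w′

  Forces-map : ∀ i j {v w} {Q Q′ : V → V → Set} →
               (∀ {v′ w′} → Q v′ w′ → Q′ v′ w′) →
               Forces i j v w Q → Forces i j v w Q′
  Forces-map ◇ j Q⊆Q′ f e = Reach-map j Q⊆Q′ (f e)
  Forces-map □ j Q⊆Q′ r   = Reach-map j (λ (v′ , e , q) → v′ , e , Q⊆Q′ q) r

  Forces? : ∀ i j v w {Q : V → V → Set} → (∀ v′ w′ → Dec (Q v′ w′)) →
            Dec (Forces i j v w Q)
  Forces? ◇ j v w Q? = •⊆? v λ v′ → Reach? j w (Q? v′)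
  Forces? □ j v w Q? = Reach? j w λ w′ → •≬? v λ v′ → Q? v′ w′

  Forces⇒Response : ∀ i j {v w} {Q : V → V → Set} → Forces i j v w Q →
                    Σ (Response i j v w) λ r →
                      ∀ {v′ w′} → Outcome i j r v′ w′ → Q v′ w′
  Forces⇒Response ◇ ◇ f =
    (λ (v′ , e) → let w′ , e′ , _ = f e in w′ , e′) ,
    λ { (e , refl) → proj₂ (proj₂ (f e)) }
  Forces⇒Response ◇ □ f = tt , λ (e , e′) → f e e′
  Forces⇒Response □ ◇ (w′ , e′ , v′ , e , q) =
    ((w′ , e′) , (v′ , e)) , λ { (refl , refl) → q }
  Forces⇒Response □ □ f =
    (λ (w′ , e′) → let v′ , e , _ = f e′ in v′ , e) ,
    λ { (e′ , refl) → proj₂ (proj₂ (f e′)) }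

  -- One round is determined: `Q` is decidable and `V` finite, so each failing universal quantifier
  -- yields a counterexample for Spoiler to play.
  ¬Forces⇒Outcome : ∀ i j {v w} {Q : V → V → Set} →
                    (∀ v′ w′ → Dec (Q v′ w′)) → ¬ Forces i j v w Q →
                    (r : Response i j v w) →
                    ∃[ v′ ] ∃[ w′ ] Outcome i j r v′ w′ × ¬ Q v′ w′
  ¬Forces⇒Outcome ◇ ◇ {v} {w} Q? ¬f r =
    let v′ , e , ¬r = •⊈⇒escape v (λ v′ → •≬? w (Q? v′)) ¬f
        w′ , e′     = r (v′ , e)
    in v′ , w′ , (e , refl) , λ q → ¬r (w′ , e′ , q)
  ¬Forces⇒Outcome ◇ □ {v} {w} Q? ¬f _ =
    let v′ , e , ¬r  = •⊈⇒escape v (λ v′ → •⊆? w (Q? v′)) ¬f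
        w′ , e′ , ¬q = •⊈⇒escape w (Q? v′) ¬r
    in v′ , w′ , (e , e′) , ¬q
  ¬Forces⇒Outcome □ ◇ Q? ¬f ((w′ , e′) , (v′ , e)) =
    v′ , w′ , (refl , refl) , λ q → ¬f (w′ , e′ , v′ , e , q)
  ¬Forces⇒Outcome □ □ {v} {w} Q? ¬f r =
    let w′ , e′ , ¬r = •⊈⇒escape w (λ w′ → •≬? v (λ v′ → Q? v′ w′)) ¬f
        v′ , e       = r (w′ , e′)
    in v′ , w′ , (e′ , refl) , λ q → ¬r (v′ , e , q)

  anyResponse : ∀ i j v w → Response i j v w
  anyResponse ◇ ◇ v w _ = total w
  anyResponse ◇ □ v w   = tt
  anyResponse □ ◇ v w   = total w , total v
  anyResponse □ □ v w _ = total v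

  -- The finitely many positions that moves lead to.

  vertices : List V
  vertices = map from (allFin (proj₁ finite))

  ∈-vertices : ∀ v → v ∈ vertices
  ∈-vertices v = subst (_∈ vertices) (strictlyInverseʳ v) (∈-map⁺ from (∈-allFin (to v)))

  obligations : List K
  obligations = ✓ ∷ concatMap (λ v → applyUpTo owed (suc (Ω v))) vertices

  γ∈obligations : ∀ v w k → γᵥ v w k ∈ obligations
  γ∈obligations v w k with γ (Ω v) (Ω w) k | γ-bounded (Ω v) (Ω w) k
  ... | _ | inj₁ refl             = here refl
  ... | _ | inj₂ (j , j≤Ωv , refl) =
    there (∈-concatMap⁺ _ (lose (∈-vertices v) (∈-applyUpTo⁺ owed (s≤s j≤Ωv))))

  positions : List Position
  positions = cartesianProduct vertices (cartesianProduct vertices obligations)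

  next∈positions : ∀ v w k → (v , w , γᵥ v w k) ∈ positions
  next∈positions v w k =
    ∈-cartesianProduct⁺ (∈-vertices v)
      (∈-cartesianProduct⁺ (∈-vertices w) (γ∈obligations v w k))

  -- Decidable regions and the one-step operator.

  record Region : Set₁ where
    constructor region
    field
      holds  : Pred Position 0ℓ
      holds? : Decidable holds
  open Region

  -- A comparison on the finitely many positions that moves can lead to.
  infix 4 _⊑_
  _⊑_ : Region → Region → Set
  X ⊑ Y = ∀ {p} → p ∈ positions → holds X p → holds Y p

  target : K → Region → Region → Region
  target ✓        Y X = Y
  target (owed _) Y X = X

  target-mono : ∀ k {Y Y′ X X′} → Y ⊑ Y′ → X ⊑ X′ → target k Y X ⊑ target k Y′ X′
  target-mono ✓        Y⊑Y′ X⊑X′ = Y⊑Y′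
  target-mono (owed _) Y⊑Y′ X⊑X′ = X⊑X′

  ForcesNext : Position → Pred Position 0ℓ → Set
  ForcesNext (v , w , k) P =
    Forces (owner v) (owner w) v w λ v′ w′ → P (v′ , w′ , γᵥ v′ w′ k)

  -- Abstract, so that unification can read Y, X and p off holds (Φ Y X) p.
  abstract
    Φ : Region → Region → Region
    Φ Y X = region
      (λ p → ForcesNext p (holds (target (obligation p) Y X)))
      (λ (v , w , k) → Forces? (owner v) (owner w) v w
        λ v′ w′ → holds? (target k Y X) (v′ , w′ , γᵥ v′ w′ k))

    Φ⇒ForcesNext : ∀ {Y X p} → holds (Φ Y X) p →
                   ForcesNext p (holds (target (obligation p) Y X))
    Φ⇒ForcesNext p∈ = p∈

    ForcesNext⇒Φ : ∀ {Y X} p → ForcesNext p (holds (target (obligation p) Y X)) →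
                   holds (Φ Y X) p
    ForcesNext⇒Φ _ f = f

  -- `Φ` consults its arguments only at positions reached by a move, all of them listed; hence
  -- comparison on the list gives inclusion at every position.
  Φ-mono : ∀ {Y Y′ X X′} → Y ⊑ Y′ → X ⊑ X′ → holds (Φ Y X) ⊆ holds (Φ Y′ X′)
  Φ-mono {Y} {Y′} {X} {X′} Y⊑Y′ X⊑X′ {v , w , k} p∈ =
    ForcesNext⇒Φ (v , w , k) (Forces-map (owner v) (owner w)
      (λ {v′} {w′} → target-mono k {Y} {Y′} {X} {X′} Y⊑Y′ X⊑X′ (next∈positions v′ w′ k))
      (Φ⇒ForcesNext p∈))

  -- The inner least fixed point.

  module Attractor (Y : Region) where

    stage : ℕ → Region
    stage = fold (region _ ∅?) (Φ Y)

    stage-increasing : ∀ n → holds (stage n) ⊆ holds (stage (suc n))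
    stage-increasing zero    ()
    stage-increasing (suc n) =
      Φ-mono {Y} {Y} {stage n} {stage (suc n)} (λ _ → id) (λ _ → stage-increasing n)

    stage-mono : ∀ {m n} → m ≤′ n → holds (stage m) ⊆ holds (stage n)
    stage-mono ≤′-refl                = id
    stage-mono {n = suc n} (≤′-step m≤n) = stage-increasing n ∘ stage-mono m≤n

    stageIndex-< : ∀ {m n p} → holds (stage n) p → ¬ holds (stage m) p → m < n
    stageIndex-< {m} {n} p∈n p∉m =
      ≰⇒> λ n≤m → p∉m (stage-mono (≤⇒≤′ n≤m) p∈n)

    stable : ∃ (StableOn positions (holds ∘ stage))
    stable = increasing⇒stable positions _ (holds? ∘ stage) stage-increasing

    bound : ℕ
    -- Stability holds only on the listed positions; one more application of `Φ` turns it into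
    -- closure at every position.
    bound = suc (proj₁ stable)

    attractor : Region
    attractor = stage bound

    attractor-closed : holds (Φ Y attractor) ⊆ holds attractor
    attractor-closed =
      Φ-mono {Y} {Y} {attractor} {stage (proj₁ stable)} (λ _ → id) (proj₂ stable)

    stage⊆closed : ∀ X → holds (Φ Y X) ⊆ holds X → ∀ n → holds (stage n) ⊆ holds X
    stage⊆closed X closed zero    ()
    stage⊆closed X closed (suc n) =
      closed ∘ Φ-mono {Y} {Y} {stage n} {X} (λ _ → id) (λ _ → stage⊆closed X closed n)

    firstStage : ∀ n {p} → holds (stage n) p →
                 ∃[ i ] holds (stage (suc i)) p × ¬ holds (stage i) p
    firstStage (suc n) {p} p∈ with holds? (stage n) p
    ... | yes p∈n = firstStage n p∈n
    ... | no  p∉n = n , p∈ , p∉n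

  -- The outer greatest fixed point.

  open Attractor using (attractor; attractor-closed)

  attractor-mono : ∀ {Y Y′} → Y ⊑ Y′ → holds (attractor Y) ⊆ holds (attractor Y′)
  attractor-mono {Y} {Y′} Y⊑Y′ =
    Attractor.stage⊆closed Y (attractor Y′)
      (attractor-closed Y′ ∘ Φ-mono {Y} {Y′} {attractor Y′} {attractor Y′} Y⊑Y′ (λ _ → id))
      (Attractor.bound Y)

  approx : ℕ → Region
  approx = fold (region _ U?) attractor

  approx-decreasing : ∀ n → holds (approx (suc n)) ⊆ holds (approx n)
  approx-decreasing zero    _ = tt
  approx-decreasing (suc n) =
    attractor-mono {approx (suc n)} {approx n} (λ _ → approx-decreasing n)

  -- The approximations decrease, so their complements increase and stabilise like the stages.
  approx-stable : ∃ (StableOn positions λ n → ∁ (holds (approx n)))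
  approx-stable = increasing⇒stable positions _ (λ n → ∁? (holds? (approx n)))
    (λ n p∉n p∈1+n → p∉n (approx-decreasing n p∈1+n))

  lastApprox : ℕ
  -- The successor again extends an inclusion on listed positions to all positions, in
  -- `W⊆attractor`.
  lastApprox = suc (proj₁ approx-stable)

  W : Region
  W = approx lastApprox

  W⊆attractor : holds W ⊆ holds (attractor W)
  W⊆attractor = attractor-mono {approx n} {approx (suc n)} λ {p} p∈ p∈n →
    decidable-stable (holds? (approx (suc n)) p) λ p∉ → proj₂ approx-stable p∈ p∉ p∈n
    where
    n : ℕ
    n = proj₁ approx-stable

  attractor⊆W : holds (attractor W) ⊆ holds W
  attractor⊆W = approx-decreasing lastApprox

  -- Well-founded simulations lie in every approximation.

  open IsWellFoundedDelayedSimulation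

  simulation⇒Forces : ∀ {R} (sim : IsWellFoundedDelayedSimulation R) {v w k} →
                      R v k w → Forces (owner v) (owner w) v w (Good sim v w k)
  simulation⇒Forces sim {v} {w} vRw = go (owner v) refl
    where
    go : ∀ i → owner v ≡ i → Forces i (owner w) v w (Good sim v w _)
    go ◇ eq e = ⟶◇⇒Reach refl (simulate-◇ sim vRw eq _ e)
    go □ eq   = ⟶◇⇒Reach refl (simulate-□ sim vRw eq)

  Forces⇒simulate-◇ : ∀ {i v w} {Q : V → V → Set} → Forces i (owner w) v w Q →
                      i ≡ ◇ → ∀ v′ → v ⟶ v′ → w ⟶⟨ ◇ ⟩ Q v′
  Forces⇒simulate-◇ f refl v′ e = Reach⇒⟶◇ refl (f e)

  Forces⇒simulate-□ : ∀ {i v w} {Q : V → V → Set} → Forces i (owner w) v w Q →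
                      i ≡ □ → w ⟶⟨ ◇ ⟩ λ w′ → ∃[ v′ ] v ⟶ v′ × Q v′ w′
  Forces⇒simulate-□ f refl = Reach⇒⟶◇ refl f

  -- Induction on `n`, and within it along the well-founded order: a move from `✓` passes to a
  -- smaller `n`, any other move descends in the order.
  simulation⊆approx : ∀ {R} → IsWellFoundedDelayedSimulation R →
                      ∀ n {v w k} → R v k w → holds (approx n) (v , w , k)
  simulation⊆approx     sim zero    vRw = tt
  simulation⊆approx {R} sim (suc n) vRw = go vRw (wellFounded sim _)
    where
    go : ∀ {v w k} → R v k w → Acc (_⋖_ sim) (v , w , k) →
         holds (approx (suc n)) (v , w , k)
    go {v} {w} {✓} vRw _ =
      attractor-closed (approx n) (ForcesNext⇒Φ (v , w , ✓) (Forces-map (owner v) (owner w)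
        (λ (v′Rw′ , _) → simulation⊆approx sim n v′Rw′)
        (simulation⇒Forces sim vRw)))
    go {v} {w} {owed j} vRw (acc rs) =
      attractor-closed (approx n) (ForcesNext⇒Φ (v , w , owed j) (Forces-map (owner v) (owner w)
        (λ { (v′Rw′ , inj₂ ⋖p) → go v′Rw′ (rs ⋖p) })
        (simulation⇒Forces sim vRw)))

  -- The region `W` as a well-founded delayed simulation.

  module Canonical where
    open Attractor W using (stage; stage-mono; bound; firstStage; stageIndex-<; stage⊆closed)

    infix 4 _≺_
    -- Stages are nested, so `p` enters strictly before `q`, or `q` never enters. Positions in no
    -- stage are thus covered too.
    _≺_ : Position → Position → Set
    p ≺ q = ∃[ n ] holds (stage n) p × ¬ holds (stage n) q

    -- A predecessor lies in a stage that `p` misses, hence in one of smaller index; the recursion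
    -- is on a bound `b` for the index.
    ≺-acc : ∀ n {p} → holds (stage n) p → Acc _≺_ p
    ≺-acc n {p} = go n n ≤-refl
      where
      go : ∀ b n → n ≤ b → ∀ {p} → holds (stage n) p → Acc _≺_ p
      go zero    zero    _   ()
      go (suc b) n       n≤b p∈n = acc λ (m , q∈m , p∉m) →
        go b m (≤-pred (≤-trans (stageIndex-< {m} {n} p∈n p∉m) n≤b)) q∈m

    stage⊆W : ∀ n → holds (stage n) ⊆ holds W
    stage⊆W n = attractor⊆W ∘ stage⊆closed (attractor W) (attractor-closed W) n

    W-good : ∀ {v w k} → holds W (v , w , k) →
             Forces (owner v) (owner w) v w λ v′ w′ →
               let p′ = (v′ , w′ , γᵥ v′ w′ k)
               in holds W p′ × (k ≡ ✓ ⊎ p′ ≺ (v , w , k))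
    W-good {v} {w} {k} p∈W with firstStage bound (W⊆attractor p∈W)
    W-good {v} {w} {✓}      p∈W | _ , p∈1+i , _   =
      Forces-map (owner v) (owner w) (λ p′∈W → p′∈W , inj₁ refl) (Φ⇒ForcesNext p∈1+i)
    W-good {v} {w} {owed _} p∈W | i , p∈1+i , p∉i =
      Forces-map (owner v) (owner w)
        -- The next position lies in stage `i`, which the current one misses: a descent in `≺`.
        (λ p′∈i → stage⊆W i p′∈i , inj₂ (i , p′∈i , p∉i))
        (Φ⇒ForcesNext p∈1+i)

    W-simulation : IsWellFoundedDelayedSimulation λ v k w → holds W (v , w , k)
    W-simulation = record
      { _⋖_ = _≺_
      ; isStrictPartialOrder = record
        { isEquivalence = isEquivalence
        ; irrefl        = λ { refl (_ , p∈ , p∉) → p∉ p∈ }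
        ; trans         = λ (m , p∈m , q∉m) (n , q∈n , r∉n) →
            m , p∈m , λ r∈m → r∉n (stage-mono
              (≤⇒≤′ (<⇒≤ (stageIndex-< {m} {n} q∈n q∉m))) r∈m)
        ; <-resp-≈      = resp₂ _≺_
        }
      -- `p` itself may lie in no stage, but everything below it lies in some stage.
      ; wellFounded = λ p → acc λ (n , q∈n , _) → ≺-acc n q∈n
      ; simulate-◇  = λ p∈W → Forces⇒simulate-◇ (W-good p∈W)
      ; simulate-□  = λ p∈W → Forces⇒simulate-□ (W-good p∈W)
      }

  -- A positional winning strategy from a decidable simulation.

  decidable⇒winning : ∀ {R} → IsWellFoundedDelayedSimulation R →
                      (∀ v k w → Dec (R v k w)) →
                      ∃[ σ ] ∀ {v w k} → R v k w → Winning σ (v , w , k)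
  decidable⇒winning {R} sim R? = (λ _ → respond) , winning
    where
    InR : Pred Position 0ℓ
    InR (v , w , k) = R v k w

    respond : ∀ ((v , w , k) : Position) → Response (owner v) (owner w) v w
    respond (v , w , k) with R? v k w
    ... | yes vRw = proj₁ (Forces⇒Response (owner v) (owner w) (simulation⇒Forces sim vRw))
    -- Arbitrary legal moves: consistent plays that start in `R` never leave it.
    ... | no  _   = anyResponse (owner v) (owner w) v w

    respond-good : ∀ p {p′} → InR p → Step p (respond p) p′ →
                   InR p′ × (obligation p ≡ ✓ ⊎ _⋖_ sim p′ p)
    respond-good (v , w , k) vRw (outcome , k′≡) with R? v k w
    ... | no ¬vRw  = contradiction vRw ¬vRw
    -- The response was built from the proof that `R?` returns, so the outcome is read against
    -- `vRw′`.
    ... | yes vRw′ with refl ← k′≡ =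
      proj₂ (Forces⇒Response (owner v) (owner w) (simulation⇒Forces sim vRw′)) outcome

    winning : ∀ {v w k} → R v k w → Winning (λ _ → respond) (v , w , k)
    winning vRw π π₀≡ consistent n = go n (wellFounded sim (π n))
      where
      inR : ∀ j → InR (π j)
      inR zero    = subst InR (sym π₀≡) vRw
      inR (suc j) = proj₁ (respond-good (π j) (inR j) (consistent j))

      -- Until `✓` occurs the play descends in the order, so accessibility bounds the wait.
      go : ∀ n → Acc (_⋖_ sim) (π n) → ∃[ j ] n ≤ j × obligation (π j) ≡ ✓
      go n (acc rs) with respond-good (π n) (inR n) (consistent n)
      ... | _ , inj₁ k≡✓ = n , ≤-refl , k≡✓
      ... | _ , inj₂ ⋖πn =
        let j , n<j , kⱼ≡✓ = go (suc n) (rs ⋖πn) in j , <⇒≤ n<j , kⱼ≡✓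

  -- Spoiler's counterplay outside `W`.

  spoiledIndex : K → ℕ → ℕ
  spoiledIndex ✓        i = pred i
  spoiledIndex (owed _) i = i

  Spoiled : Strategy → List Position → ℕ → Position → Position → Set
  Spoiled σ h i p p′ =
    Step p (σ h p) p′ × ¬ holds (approx (spoiledIndex (obligation p) i)) p′

  -- `approx (suc i)` is closed under `Φ (approx i)`, so outside it Duplicator cannot force
  -- `approx i` from `✓`, nor `approx (suc i)` otherwise.
  spoil : ∀ σ h i p → ¬ holds (approx i) p → ∃ (Spoiled σ h i p)
  spoil σ h zero    p           p∉ = contradiction tt p∉
  spoil σ h (suc i) (v , w , k) p∉ =
    let v′ , w′ , outcome , ∉target =
          ¬Forces⇒Outcome (owner v) (owner w)
            (λ v′ w′ → holds? (target k (approx i) (approx (suc i))) (v′ , w′ , γᵥ v′ w′ k))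
            (λ f → p∉ (attractor-closed (approx i) (ForcesNext⇒Φ (v , w , k) f)))
            (σ h (v , w , k))
    in (v′ , w′ , γᵥ v′ w′ k) , (outcome , refl) , ∉approx k ∉target
    where
    ∉approx : ∀ k {p′} → ¬ holds (target k (approx i) (approx (suc i))) p′ →
              ¬ holds (approx (spoiledIndex k (suc i))) p′
    ∉approx ✓        = id
    ∉approx (owed _) = id

  -- `approx 0` contains every position, so an index with a position outside is positive.
  outside⇒pred< : ∀ {p} i → ¬ holds (approx i) p → pred i < i
  outside⇒pred< zero    p∉ = contradiction tt p∉
  outside⇒pred< (suc i) _  = ≤-refl

  module SpoilerPlay (σ : Strategy) (i₀ : ℕ) (p₀ : Position)
                     (p₀∉ : ¬ holds (approx i₀) p₀) where

    record State : Set where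
      constructor state
      field
        history  : List Position
        index    : ℕ
        position : Position
        outside  : ¬ holds (approx index) position
    open State

    advance : State → State
    advance (state h i p p∉) =
      let p′ , _ , p′∉ = spoil σ h i p p∉
      in state (p ∷ h) (spoiledIndex (obligation p) i) p′ p′∉

    states : ℕ → State
    states = fold (state [] i₀ p₀ p₀∉) advance

    play : ℕ → Position
    play = position ∘ states

    indices : ℕ → ℕ
    indices = index ∘ states

    history≡ : ∀ n → history (states n) ≡ applyDownFrom play n
    history≡ zero    = refl
    history≡ (suc n) = cong (play n ∷_) (history≡ n)

    consistent : Consistent σ play
    consistent n = subst (λ h → Step (play n) (σ h (play n)) (play (suc n))) (history≡ n)
      (proj₁ (proj₂ (spoil σ _ (indices n) (play n) (outside (states n)))))

    indices-antitone : ∀ {m n} → m ≤′ n → indices n ≤ indices m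
    indices-antitone ≤′-refl                = ≤-refl
    indices-antitone {n = suc n} (≤′-step m≤n) =
      ≤-trans (spoiledIndex≤ (obligation (play n))) (indices-antitone m≤n)
      where
      spoiledIndex≤ : ∀ k {i} → spoiledIndex k i ≤ i
      spoiledIndex≤ ✓        = pred[n]≤n
      spoiledIndex≤ (owed _) = ≤-refl

    indices-drop : ∀ n → obligation (play n) ≡ ✓ → indices (suc n) < indices n
    indices-drop n k≡✓ =
      subst (λ k → spoiledIndex k (indices n) < indices n) (sym k≡✓)
        (outside⇒pred< (indices n) (outside (states n)))

    -- Each `✓` strictly lowers the index, which never rises; infinitely many would give an infinite
    -- descent in the naturals.
    lost : ¬ WonByDuplicator play
    lost won = go (suc i₀) 0 ≤-refl
      where
      go : ∀ b n → ¬ indices n < b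
      go (suc b) n i<b =
        let j , n≤j , k≡✓ = won n
        in go b (suc j) (≤-trans (indices-drop j k≡✓)
             (≤-trans (indices-antitone (≤⇒≤′ n≤j)) (≤-pred i<b)))

  -- Decidability of `W` justifies the argument by contradiction.
  winning⇒W : ∀ σ {p} → Winning σ p → holds W p
  winning⇒W σ {p} winning = decidable-stable (holds? W p) λ p∉W →
    let open SpoilerPlay σ lastApprox p p∉W in lost (winning play refl consistent)

theorem3 : (G : ParityGame) →
    let open ParityGame G
        open DelayedSimulation G
    in (v w : V) → v ⊑de w ⇔ v ≤de w
theorem3 G v w = mk⇔
  (λ (σ , winning) → _ , W-simulation G , winning⇒W G σ winning)
  -- `R` may be undecidable; it serves to place the start in `W`, whose own simulation supplies the
  -- strategy.
  (λ (R , sim , vRw) →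
    let σ , wins = decidable⇒winning G (W-simulation G) λ v k w → holds? (W G) (v , w , k)
    in σ , wins (simulation⊆approx G sim (lastApprox G) vRw))
  where
  open Canonical
  open Region
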